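{- Let $L$ be a finite modular lattice with minimum element $\bot$. Then \[J(\mathsf{Sat}(L)) = J(\mathsf{Tr}(L)) \cap \mathsf{Sat}(L) = \{\lfloor H \to K\rfloor : H<K \text{ is a covering relation in } L\}\] and \[M(\mathsf{Sat}(L)) = M(\mathsf{Tr}(L)) \cap \mathsf{Sat}(L) = \{\lceil \bot \to X\rceil^{\mathrm{rlp}} : X \in L,\ X \neq \bot\}.\] Moreover, for every covering relation $H<K$ in $L$ and every $X \in L$ with $X \neq \bot$, \[\lfloor H \to K\rfloor \subseteq \lceil \bot \to X\rceil^{\mathrm{rlp}} \iff (X \nleq K \text{ or } X \leq H).\]
   Context: Let $(L,\le)$ be a lattice. An arrow in $L$ is a pair $x \to y$ with $x \le y$. Relations refining $\le$ are identified with sets of arrows. A transfer system on $L$ is a partial order $\to$ on $L$ such that (1) $x\to y$ implies $x\le y$; (2) if $x\to y$ and $z\le y$ then $x\wedge z\to z$. A cotransfer system on $L$ is a partial order $\to$ on $L$ such that (1) $x\to y$ implies $x\le y$; (2) if $x\to y$ and $x\le z$ then $z\to y\vee z$. A transfer system is saturated if whenever $x\le y\le z$ and any two of $x\to y$, $x\to z$, $y\to z$ hold, so does the third (equivalently: $x \le y \le z$ and $x\to z$ imply $y\to z$). $\mathsf{Tr}(L)$ is the set of transfer systems on $L$ and $\mathsf{Sat}(L)$ the set of saturated transfer systems on $L$. Both are ordered by containment and are lattices with meet given by intersection (the joins need not agree). For $x\le y$, $\lfloor x\to y\rfloor$ is the smallest transfer system containing $x\to y$, and $\lceil x\to y\rceil$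 is the smallest cotransfer system containing $x\to y$. For arrows $f: x\le y$ and $g: x'\le y'$, say that $(f,g)$ has the lifting property if the implication "$x\le x'$ and $y\le y'$ imply $y\le x'$" holds. For a set $S$ of arrows, its right lifting class is $S^{\mathrm{rlp}}=\{f : (g,f) \text{ has the lifting property for all } g\in S\}$. A covering relation is $x<y$ with no $z$ satisfying $x<z<y$. For a finite lattice $P$, $J(P)$ is the set of join-irreducible elements ($x$ not the minimum, and $x=a\vee b$ implies $x=a$ or $x=b$) and $M(P)$ is the set of meet-irreducible elements ($x$ not the maximum, and $x=a\wedge b$ implies $x=a$ or $x=b$). -}

module Defs where

open import Level using (Level; Lift; lift; lower; _⊔_) renaming (suc to lsuc)
open import Data.Nat.Base using (ℕ; _*_)
open import Data.Bool.Base using (Bool; true)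
import Data.Bool.Properties as Bool
open import Data.Fin.Base using (Fin; combine; remQuot)
import Data.Fin.Properties as Fin
open import Data.Fin.Subset using (Subset)
open import Data.Fin.Subset.Properties using (anySubset?)
open import Data.Vec.Base using (lookup; tabulate)
open import Data.Vec.Properties using (lookup∘tabulate)
open import Data.Product.Base using (∃; _×_; _,_; proj₁; proj₂; uncurry)
open import Data.Sum.Base using (_⊎_)
open import Function.Base using (_∘_; _on_; id)
open import Function.Bundles using (Inverse)
open import Relation.Nullary.Negation using (¬_)
open import Relation.Nullary.Decidable using (Dec; yes; no; map′; does; _×-dec_; _→-dec_; ¬?; decidable-stable; dec-true)
open import Relation.Unary using (Pred; Decidable)
open import Relation.Binary.Core using (Rel; _⇒_; _⇔_)
open import Relation.Binary.Definitions using (Minimum; Maximum; _Respects₂_) renaming (Decidable to Decidable₂)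
open import Relation.Binary.Structures using (IsPartialOrder)
open import Relation.Binary.Lattice using (Lattice)
import Relation.Binary.Construct.NonStrictToStrict as ToStrict
open import Relation.Binary.PropositionalEquality using (_≡_; sym; trans; cong; cong₂; setoid)

module _ {c ℓ₁ ℓ₂} (L : Lattice c ℓ₁ ℓ₂) where
  open Lattice L renaming (setoid to ≈-setoid)

  Finite : Set (c ⊔ ℓ₁)
  Finite = ∃ λ n → Inverse ≈-setoid (setoid (Fin n))

  Modular : Set (c ⊔ ℓ₁ ⊔ ℓ₂)
  Modular = ∀ x y z → x ≤ z → x ∨ (y ∧ z) ≈ (x ∨ y) ∧ z

  J : Pred Carrier (c ⊔ ℓ₁ ⊔ ℓ₂)
  J x = ¬ Minimum _≤_ x × (∀ a b → x ≈ a ∨ b → x ≈ a ⊎ x ≈ b)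

  M : Pred Carrier (c ⊔ ℓ₁ ⊔ ℓ₂)
  M x = ¬ Maximum _≤_ x × (∀ a b → x ≈ a ∧ b → x ≈ a ⊎ x ≈ b)

module TransferSystems {c ℓ₁ ℓ₂} (L : Lattice c ℓ₁ ℓ₂) (finite : Finite L) where
  open Lattice L hiding (setoid) renaming (trans to ≤-trans)
  open ToStrict _≈_ _≤_ using (_<_)

  private
    ℓ : Level
    ℓ = c ⊔ ℓ₁ ⊔ ℓ₂

  infix 4 _⋖_
  _⋖_ : Rel Carrier ℓ
  x ⋖ y = x < y × ¬ ∃ λ z → x < z × z < y

  ⋖⇒≤ : _⋖_ ⇒ _≤_
  ⋖⇒≤ = proj₁ ∘ proj₁

  -- A set of arrows of a finite lattice is a finite set, hence decidable; without
  -- decidability the collection of all sets of arrows would not be finite constructively.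
  record ArrowSet : Set (lsuc ℓ) where
    field
      Arr     : Rel Carrier ℓ
      refines : Arr ⇒ _≤_
      resp    : Arr Respects₂ _≈_
      arr?    : Decidable₂ Arr

    arr-resp : ∀ {x x′ y y′} → x ≈ x′ → y ≈ y′ → Arr x y → Arr x′ y′
    arr-resp p q = proj₁ resp q ∘ proj₂ resp p

  open ArrowSet public

  infix 4 _∋_⟶_ _⊑_ _≋_

  _∋_⟶_ : ArrowSet → Rel Carrier ℓ
  R ∋ x ⟶ y = Arr R x y

  _⊑_ : Rel ArrowSet ℓ
  R ⊑ S = Arr R ⇒ Arr S

  _≋_ : Rel ArrowSet ℓ
  R ≋ S = Arr R ⇔ Arr S

  record IsTransferSystem (R : ArrowSet) : Set ℓ where
    field
      isPartialOrder : IsPartialOrder _≈_ (Arr R)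
      restrict       : ∀ {x y z} → R ∋ x ⟶ y → z ≤ y → R ∋ (x ∧ z) ⟶ z

  record IsCotransferSystem (R : ArrowSet) : Set ℓ where
    field
      isPartialOrder : IsPartialOrder _≈_ (Arr R)
      corestrict     : ∀ {x y z} → R ∋ x ⟶ y → x ≤ z → R ∋ z ⟶ (y ∨ z)

  Saturated : Pred ArrowSet ℓ
  Saturated R = ∀ x y z → x ≤ y → y ≤ z →
      (R ∋ x ⟶ y → R ∋ x ⟶ z → R ∋ y ⟶ z)
    × (R ∋ x ⟶ y → R ∋ y ⟶ z → R ∋ x ⟶ z)
    × (R ∋ x ⟶ z → R ∋ y ⟶ z → R ∋ x ⟶ y)

  IsSaturatedTransferSystem : Pred ArrowSet ℓ
  IsSaturatedTransferSystem R = IsTransferSystem R × Saturated R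

  LiftingProperty : (x y x′ y′ : Carrier) → Set ℓ₂
  LiftingProperty x y x′ y′ = x ≤ x′ → y ≤ y′ → y ≤ x′

  private
    open module Enum = Inverse (proj₂ finite) using (to; from; to-cong; strictlyInverseʳ)

    n : ℕ
    n = proj₁ finite

  _≈?_ : Decidable₂ _≈_
  x ≈? y = map′ (λ p → Eq.trans (Eq.sym (strictlyInverseʳ x))
                  (Eq.trans (Eq.reflexive (cong from p)) (strictlyInverseʳ y)))
                to-cong (to x Fin.≟ to y)

  ≤-resp : ∀ {x x′ y y′} → x ≈ x′ → y ≈ y′ → x ≤ y → x′ ≤ y′
  ≤-resp p q = ≤-respʳ-≈ q ∘ ≤-respˡ-≈ p

  ∧-resp : ∀ {x x′ y y′} → x ≈ x′ → y ≈ y′ → x ∧ y ≈ x′ ∧ y′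
  ∧-resp {x} {x′} {y} {y′} p q = antisym (half p q) (half (Eq.sym p) (Eq.sym q))
    where
    half : ∀ {a a′ b b′} → a ≈ a′ → b ≈ b′ → a ∧ b ≤ a′ ∧ b′
    half {a} {a′} {b} {b′} r s =
      ∧-greatest (≤-respʳ-≈ r (x∧y≤x a b)) (≤-respʳ-≈ s (x∧y≤y a b))

  ∨-resp : ∀ {x x′ y y′} → x ≈ x′ → y ≈ y′ → x ∨ y ≈ x′ ∨ y′
  ∨-resp {x} {x′} {y} {y′} p q = antisym (half p q) (half (Eq.sym p) (Eq.sym q))
    where
    half : ∀ {a a′ b b′} → a ≈ a′ → b ≈ b′ → a ∨ b ≤ a′ ∨ b′
    half {a} {a′} {b} {b′} r s =
      ∨-least (≤-respˡ-≈ (Eq.sym r) (x≤x∨y a′ b′)) (≤-respˡ-≈ (Eq.sym s) (y≤x∨y a′ b′))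

  _≤?_ : Decidable₂ _≤_
  x ≤? y = map′ (λ p → ≤-respˡ-≈ p (x∧y≤y x y))
                (λ p → antisym (x∧y≤x x y) (∧-greatest (reflexive Eq.refl) p))
                ((x ∧ y) ≈? x)

  ∀³? : ∀ {p} {P : Carrier → Carrier → Carrier → Set p} →
        (∀ {x x′ y y′ z z′} → x ≈ x′ → y ≈ y′ → z ≈ z′ → P x y z → P x′ y′ z′) →
        (∀ x y z → Dec (P x y z)) → Dec (∀ x y z → P x y z)
  ∀³? r P? = map′
    (λ f x y z → r (strictlyInverseʳ x) (strictlyInverseʳ y) (strictlyInverseʳ z)
                   (f (to x) (to y) (to z)))
    (λ f i j k → f (from i) (from j) (from k))
    (Fin.all? λ i → Fin.all? λ j → Fin.all? λ k → P? (from i) (from j) (from k))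

  ∀²? : ∀ {p} {P : Carrier → Carrier → Set p} →
        (∀ {x x′ y y′} → x ≈ x′ → y ≈ y′ → P x y → P x′ y′) →
        (∀ x y → Dec (P x y)) → Dec (∀ x y → P x y)
  ∀²? r P? = map′ (λ f x y → f x y y) (λ f x y _ → f x y)
                  (∀³? (λ p q _ → r p q) (λ x y _ → P? x y))

  isPartialOrder⁺ : (R : ArrowSet) → (∀ x y → x ≈ y → R ∋ x ⟶ y) →
                    (∀ x y z → R ∋ x ⟶ y → R ∋ y ⟶ z → R ∋ x ⟶ z) →
                    IsPartialOrder _≈_ (Arr R)
  isPartialOrder⁺ R rfl trn = record
    { isPreorder = record
      { isEquivalence = isEquivalence
      ; reflexive     = λ {x} {y} → rfl x y
      ; trans         = λ {x} {y} {z} → trn x y z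
      }
    ; antisym = λ p q → antisym (refines R p) (refines R q)
    }

  isPartialOrder? : (R : ArrowSet) → Dec (IsPartialOrder _≈_ (Arr R))
  isPartialOrder? R = map′
    (uncurry (isPartialOrder⁺ R))
    (λ po → (λ _ _ → IsPartialOrder.reflexive po) , (λ _ _ _ → IsPartialOrder.trans po))
    (∀²? (λ p q f e → arr-resp R p q (f (Eq.trans p (Eq.trans e (Eq.sym q)))))
         (λ x y → (x ≈? y) →-dec arr? R x y)
     ×-dec
     ∀³? (λ p q r f a b → arr-resp R p r
            (f (arr-resp R (Eq.sym p) (Eq.sym q) a) (arr-resp R (Eq.sym q) (Eq.sym r) b)))
         (λ x y z → arr? R x y →-dec (arr? R y z →-dec arr? R x z)))

  isTransferSystem? : Decidable IsTransferSystem
  isTransferSystem? R = map′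
    (λ (po , f) → record { isPartialOrder = po ; restrict = λ {x} {y} {z} → f x y z })
    (λ T → IsTransferSystem.isPartialOrder T , λ _ _ _ → IsTransferSystem.restrict T)
    (isPartialOrder? R ×-dec
     ∀³? (λ p q r f a b → arr-resp R (∧-resp p r) r
            (f (arr-resp R (Eq.sym p) (Eq.sym q) a) (≤-resp (Eq.sym r) (Eq.sym q) b)))
         (λ x y z → arr? R x y →-dec ((z ≤? y) →-dec arr? R (x ∧ z) z)))

  isCotransferSystem? : Decidable IsCotransferSystem
  isCotransferSystem? R = map′
    (λ (po , f) → record { isPartialOrder = po ; corestrict = λ {x} {y} {z} → f x y z })
    (λ T → IsCotransferSystem.isPartialOrder T , λ _ _ _ → IsCotransferSystem.corestrict T)
    (isPartialOrder? R ×-dec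
     ∀³? (λ p q r f a b → arr-resp R r (∨-resp q r)
            (f (arr-resp R (Eq.sym p) (Eq.sym q) a) (≤-resp (Eq.sym p) (Eq.sym r) b)))
         (λ x y z → arr? R x y →-dec ((x ≤? z) →-dec arr? R z (y ∨ z))))

  saturated? : Decidable Saturated
  saturated? R = ∀³?
    (λ p q r f x≤y y≤z →
      let p⁻ = Eq.sym p
          q⁻ = Eq.sym q
          r⁻ = Eq.sym r
          (f₁ , f₂ , f₃) = f (≤-resp p⁻ q⁻ x≤y) (≤-resp q⁻ r⁻ y≤z)
      in (λ a b → arr-resp R q r (f₁ (arr-resp R p⁻ q⁻ a) (arr-resp R p⁻ r⁻ b)))
       , (λ a b → arr-resp R p r (f₂ (arr-resp R p⁻ q⁻ a) (arr-resp R q⁻ r⁻ b)))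
       , (λ a b → arr-resp R p q (f₃ (arr-resp R p⁻ r⁻ a) (arr-resp R q⁻ r⁻ b))))
    (λ x y z → (x ≤? y) →-dec ((y ≤? z) →-dec
      ((arr? R x y →-dec (arr? R x z →-dec arr? R y z)) ×-dec
       ((arr? R x y →-dec (arr? R y z →-dec arr? R x z)) ×-dec
        (arr? R x z →-dec (arr? R y z →-dec arr? R x y))))))

  isSaturatedTransferSystem? : Decidable IsSaturatedTransferSystem
  isSaturatedTransferSystem? R = isTransferSystem? R ×-dec saturated? R

  _⊑?_ : Decidable₂ _⊑_
  R ⊑? S = map′ (λ f {x} {y} → f x y) (λ f _ _ → f)
    (∀²? (λ p q f a → arr-resp S p q (f (arr-resp R (Eq.sym p) (Eq.sym q) a)))
         (λ x y → arr? R x y →-dec arr? S x y))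

  infix 8 _ʳˡᵖ
  _ʳˡᵖ : ArrowSet → ArrowSet
  S ʳˡᵖ = record
    { Arr     = rlp
    ; refines = proj₁
    ; resp    = rlp-resp Eq.refl , (λ p → rlp-resp p Eq.refl)
    ; arr?    = λ x′ y′ → (x′ ≤? y′) ×-dec
        ∀²? (λ p q f a x≤ y≤ → ≤-respˡ-≈ q
               (f (arr-resp S (Eq.sym p) (Eq.sym q) a)
                  (≤-respˡ-≈ (Eq.sym p) x≤) (≤-respˡ-≈ (Eq.sym q) y≤)))
            (λ x y → arr? S x y →-dec ((x ≤? x′) →-dec ((y ≤? y′) →-dec (y ≤? x′))))
    }
    where
    rlp : Rel Carrier ℓ
    rlp x′ y′ = x′ ≤ y′ × (∀ x y → S ∋ x ⟶ y → LiftingProperty x y x′ y′)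

    rlp-resp : ∀ {x x′ y y′} → x ≈ x′ → y ≈ y′ → rlp x y → rlp x′ y′
    rlp-resp p q (x≤y , f) = ≤-resp p q x≤y , λ u v a u≤ v≤ →
      ≤-respʳ-≈ p (f u v a (≤-respʳ-≈ (Eq.sym p) u≤) (≤-respʳ-≈ (Eq.sym q) v≤))

  private
    decode : Subset (n * n) → ArrowSet
    decode s = record
      { Arr     = λ x y → x ≤ y × Lift ℓ (lookup s (combine (to x) (to y)) ≡ true)
      ; refines = proj₁
      ; resp    = rsp Eq.refl , (λ p → rsp p Eq.refl)
      ; arr?    = λ x y → (x ≤? y) ×-dec map′ lift lower (lookup s _ Bool.≟ true)
      }
      where
      rsp : ∀ {x x′ y y′} → x ≈ x′ → y ≈ y′ →
            x ≤ y × Lift ℓ (lookup s (combine (to x) (to y)) ≡ true) →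
            x′ ≤ y′ × Lift ℓ (lookup s (combine (to x′) (to y′)) ≡ true)
      rsp p q (le , lift e) = ≤-resp p q le ,
        lift (trans (cong₂ (λ i j → lookup s (combine i j)) (sym (to-cong p)) (sym (to-cong q))) e)

    bit : ArrowSet → Fin n × Fin n → Bool
    bit R (i , j) = does (arr? R (from i) (from j))

    encode : ArrowSet → Subset (n * n)
    encode R = tabulate (bit R ∘ remQuot n)

    lookup-encode : ∀ R i j → lookup (encode R) (combine i j) ≡ bit R (i , j)
    lookup-encode R i j = trans (lookup∘tabulate (bit R ∘ remQuot n) (combine i j))
                                (cong (bit R) (Fin.remQuot-combine i j))

    does-true : ∀ {a} {A : Set a} (d : Dec A) → does d ≡ true → A
    does-true (yes a) _ = a
    does-true (no _) ()

    decode-encode : ∀ R → decode (encode R) ≋ R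
    decode-encode R = (λ (_ , lift e) →
        arr-resp R (strictlyInverseʳ _) (strictlyInverseʳ _)
          (does-true (arr? R _ _) (trans (sym (lookup-encode R _ _)) e)))
      , (λ a → refines R a , lift (trans (lookup-encode R _ _) (dec-true (arr? R _ _)
          (arr-resp R (Eq.sym (strictlyInverseʳ _)) (Eq.sym (strictlyInverseʳ _)) a))))

    ∀Subset? : ∀ {m p} {P : Pred (Subset m) p} → Decidable P → Dec (∀ s → P s)
    ∀Subset? P? = map′ (λ f s → decidable-stable (P? s) (λ ¬p → f (s , ¬p)))
                       (λ f (s , ¬p) → ¬p (f s)) (¬? (anySubset? (¬? ∘ P?)))

  _IsIntersectionOf_ : ∀ {i} {I : Set i} → ArrowSet → (I → ArrowSet) → Set (i ⊔ ℓ)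
  R IsIntersectionOf F = (∀ {x y} → R ∋ x ⟶ y → ∀ i → F i ∋ x ⟶ y)
                       × (∀ {x y} → x ≤ y → (∀ i → F i ∋ x ⟶ y) → R ∋ x ⟶ y)

  IntersectionClosed : Pred ArrowSet ℓ → Set (lsuc ℓ)
  IntersectionClosed P = ∀ {I : Set ℓ} (F : I → ArrowSet) (R : ArrowSet) →
    R IsIntersectionOf F → (∀ i → P (F i)) → P R

  -- The family ranges over codes of sets of arrows so that the intersection
  -- lives in the universe of ArrowSet; ⋂-lower removes this restriction.
  ⋂ : {P : Pred ArrowSet ℓ} → Decidable P → ArrowSet
  ⋂ {P} P? = record
    { Arr     = λ x y → x ≤ y × (∀ s → P (decode s) → decode s ∋ x ⟶ y)
    ; refines = proj₁
    ; resp    = (λ q (le , f) → ≤-respʳ-≈ q le , λ s p → arr-resp (decode s) Eq.refl q (f s p))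
              , (λ q (le , f) → ≤-respˡ-≈ q le , λ s p → arr-resp (decode s) q Eq.refl (f s p))
    ; arr?    = λ x y → (x ≤? y) ×-dec
                  ∀Subset? (λ s → P? (decode s) →-dec arr? (decode s) x y)
    }

  module _ {P : Pred ArrowSet ℓ} (closed : IntersectionClosed P) where

    ≋-closed : ∀ {R S} → R ≋ S → P R → P S
    ≋-closed {R} {S} (r⊑s , s⊑r) p =
      closed {I = Lift ℓ Bool} (λ _ → R) S
        ((λ a _ → s⊑r a) , (λ _ f → r⊑s (f (lift true)))) (λ _ → p)

    ⋂-lower : (P? : Decidable P) → ∀ {R} → P R → ⋂ P? ⊑ R
    ⋂-lower P? {R} p (_ , f) = proj₁ (decode-encode R)
      (f (encode R) (≋-closed (proj₂ (decode-encode R) , proj₁ (decode-encode R)) p))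

    ⋂-closed : {Q : Pred ArrowSet ℓ} (Q? : Decidable Q) → (∀ {R} → Q R → P R) → P (⋂ Q?)
    ⋂-closed {Q} Q? Q⊆P = closed {I = ∃ λ s → Q (decode s)} (decode ∘ proj₁) (⋂ Q?)
      ((λ (_ , f) (s , q) → f s q) , (λ le f → le , λ s q → f (s , q)))
      (Q⊆P ∘ proj₂)

  private
    po-closed : IntersectionClosed (λ R → IsPartialOrder _≈_ (Arr R))
    po-closed F R (below , above) po = isPartialOrder⁺ R
      (λ x y e → above (reflexive e) (λ i → IsPartialOrder.reflexive (po i) e))
      (λ x y z a b → above (≤-trans (refines R a) (refines R b))
        (λ i → IsPartialOrder.trans (po i) (below a i) (below b i)))

  isTransferSystem-closed : IntersectionClosed IsTransferSystem
  isTransferSystem-closed F R R≡⋂F@(below , above) T = record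
    { isPartialOrder = po-closed F R R≡⋂F (IsTransferSystem.isPartialOrder ∘ T)
    ; restrict       = λ a z≤y → above (x∧y≤y _ _)
                         (λ i → IsTransferSystem.restrict (T i) (below a i) z≤y)
    }

  isCotransferSystem-closed : IntersectionClosed IsCotransferSystem
  isCotransferSystem-closed F R R≡⋂F@(below , above) T = record
    { isPartialOrder = po-closed F R R≡⋂F (IsCotransferSystem.isPartialOrder ∘ T)
    ; corestrict     = λ a x≤z → above (y≤x∨y _ _)
                         (λ i → IsCotransferSystem.corestrict (T i) (below a i) x≤z)
    }

  isSaturatedTransferSystem-closed : IntersectionClosed IsSaturatedTransferSystem
  isSaturatedTransferSystem-closed F R R≡⋂F@(below , above) T =
      isTransferSystem-closed F R R≡⋂F (proj₁ ∘ T)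
    , λ x y z x≤y y≤z →
        (λ a b → above y≤z (λ i → proj₁ (sat i x≤y y≤z) (below a i) (below b i)))
      , (λ a b → above (≤-trans x≤y y≤z)
                   (λ i → proj₁ (proj₂ (sat i x≤y y≤z)) (below a i) (below b i)))
      , (λ a b → above x≤y (λ i → proj₂ (proj₂ (sat i x≤y y≤z)) (below a i) (below b i)))
    where
    sat : ∀ i {x y z} → _
    sat i {x} {y} {z} = proj₂ (T i) x y z

  Smallest : Pred ArrowSet ℓ → Pred ArrowSet (lsuc ℓ)
  Smallest P R = P R × (∀ {S} → P S → R ⊑ S)

  module Generate {P : Pred ArrowSet ℓ} (P? : Decidable P) (closed : IntersectionClosed P)
                  {Q : Pred ArrowSet ℓ} (Q? : Decidable Q) (Q-closed : IntersectionClosed Q) where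

    private
      both? : Decidable (λ R → P R × Q R)
      both? R = P? R ×-dec Q? R

      both-closed : IntersectionClosed (λ R → P R × Q R)
      both-closed F R R≡⋂F pq = closed F R R≡⋂F (proj₁ ∘ pq) , Q-closed F R R≡⋂F (proj₂ ∘ pq)

    generate : ArrowSet
    generate = ⋂ both?

    generate-smallest : Smallest (λ R → P R × Q R) generate
    generate-smallest = ⋂-closed both-closed both? id , ⋂-lower both-closed both?

  private
    ∋-closed : ∀ {x y} → x ≤ y → IntersectionClosed (_∋ x ⟶ y)
    ∋-closed x≤y F R (_ , above) = above x≤y

    module ⌊⌋ {x y} (x≤y : x ≤ y) =
      Generate isTransferSystem? isTransferSystem-closed (λ R → arr? R x y) (∋-closed x≤y)
    module ⌈⌉ {x y} (x≤y : x ≤ y) =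
      Generate isCotransferSystem? isCotransferSystem-closed (λ R → arr? R x y) (∋-closed x≤y)

  ⌊_⌋ : ∀ {x y} → x ≤ y → ArrowSet
  ⌊ x≤y ⌋ = ⌊⌋.generate x≤y

  ⌊⌋-smallest : ∀ {x y} (x≤y : x ≤ y) →
                Smallest (λ R → IsTransferSystem R × R ∋ x ⟶ y) ⌊ x≤y ⌋
  ⌊⌋-smallest x≤y = ⌊⌋.generate-smallest x≤y

  ⌈_⌉ : ∀ {x y} → x ≤ y → ArrowSet
  ⌈ x≤y ⌉ = ⌈⌉.generate x≤y

  ⌈⌉-smallest : ∀ {x y} (x≤y : x ≤ y) →
                Smallest (λ R → IsCotransferSystem R × R ∋ x ⟶ y) ⌈ x≤y ⌉
  ⌈⌉-smallest x≤y = ⌈⌉.generate-smallest x≤y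

  infixr 7 _⊓_
  _⊓_ : ArrowSet → ArrowSet → ArrowSet
  R ⊓ S = record
    { Arr     = λ x y → R ∋ x ⟶ y × S ∋ x ⟶ y
    ; refines = refines R ∘ proj₁
    ; resp    = (λ q (a , b) → arr-resp R Eq.refl q a , arr-resp S Eq.refl q b)
              , (λ q (a , b) → arr-resp R q Eq.refl a , arr-resp S q Eq.refl b)
    ; arr?    = λ x y → arr? R x y ×-dec arr? S x y
    }

  private
    module Closure {P : Pred ArrowSet ℓ} (P? : Decidable P) (closed : IntersectionClosed P)
                   (R S : ArrowSet) where

      ⊒-closed : IntersectionClosed (λ T → R ⊑ T × S ⊑ T)
      ⊒-closed F T (_ , above) f =
          (λ a → above (refines R a) (λ i → proj₁ (f i) a))
        , (λ a → above (refines S a) (λ i → proj₂ (f i) a))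

      ⊓-closed : P R → P S → P (R ⊓ S)
      ⊓-closed r s = closed {I = Lift ℓ Bool} pick (R ⊓ S)
        ( (λ { (a , _) (lift true) → a ; (_ , b) (lift Bool.false) → b })
        , (λ _ f → f (lift true) , f (lift Bool.false)))
        (λ { (lift true) → r ; (lift Bool.false) → s })
        where
        pick : Lift ℓ Bool → ArrowSet
        pick (lift true)       = R
        pick (lift Bool.false) = S

      open Generate P? closed (λ T → (R ⊑? T) ×-dec (S ⊑? T)) ⊒-closed public

  -- Meets are intersections; the join of R and S is the smallest member of P containing both.
  containmentLattice : {P : Pred ArrowSet ℓ} → Decidable P → IntersectionClosed P →
                       Lattice (lsuc ℓ) ℓ ℓ
  containmentLattice {P} P? closed = record
    { Carrier   = ∃ P
    ; _≈_       = _≋_ on proj₁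
    ; _≤_       = _⊑_ on proj₁
    ; _∨_       = λ (R , _) (S , _) → generate R S , proj₁ (proj₁ (generate-smallest R S))
    ; _∧_       = λ (R , r) (S , s) → R ⊓ S , ⊓-closed R S r s
    ; isLattice = record
      { isPartialOrder = record
        { isPreorder = record
          { isEquivalence = record
            { refl  = id , id
            ; sym   = λ (f , g) → g , f
            ; trans = λ (f , g) (f′ , g′) → f′ ∘ f , g ∘ g′
            }
          ; reflexive = proj₁
          ; trans     = λ f g → g ∘ f
          }
        ; antisym = _,_
        }
      ; supremum = λ (R , _) (S , _) →
            proj₁ (proj₂ (proj₁ (generate-smallest R S)))
          , proj₂ (proj₂ (proj₁ (generate-smallest R S)))
          , λ (T , t) R⊑T S⊑T → proj₂ (generate-smallest R S) (t , R⊑T , S⊑T)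
      ; infimum  = λ _ _ → proj₁ , proj₂ , λ _ f g a → f a , g a
      }
    }
    where open Closure P? closed

  Tr : Lattice (lsuc ℓ) ℓ ℓ
  Tr = containmentLattice isTransferSystem? isTransferSystem-closed

  Sat : Lattice (lsuc ℓ) ℓ ℓ
  Sat = containmentLattice isSaturatedTransferSystem? isSaturatedTransferSystem-closed

  -- Elements of Tr and Sat are sets of arrows together with proofs; ⟪ X ⟫ forgets the
  -- proofs, so that subsets of Tr and of Sat can be compared.
  ⟪_⟫ : ∀ {p q} {P : Pred ArrowSet p} → Pred (∃ P) q → Pred ArrowSet (lsuc ℓ ⊔ p ⊔ q)
  ⟪ X ⟫ R = ∃ λ T → X T × proj₁ T ≋ R

{-# OPTIONS --safe #-}
-- A saturated transfer system R is determined by its covers: if x → z in R and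
-- x ≤ y ≤ z, then x → y by restriction and hence y → z by saturation, so every arrow
-- of R is a composite of covers of R. Conversely, if H ⋖ K, then by modularity no
-- element lies strictly between the ends of an arrow of ⌊ H → K ⌋, so that every
-- transfer system inside ⌊ H → K ⌋ is saturated. Removing the arrows above
-- H → K from ⌊ H → K ⌋ leaves the unique maximal proper one, whence ⌊ H → K ⌋ is
-- join-irreducible.
--
-- Dually, ⌈ ⊥ → X ⌉ʳˡᵖ consists of the x ≤ y such that X ≤ y implies X ≤ x. A transfer
-- system properly containing it contains ⊥ → X, so it is meet-irreducible. If R is
-- saturated and x ≤ y is not in R, then the least X with X → y in R receives no
-- nontrivial arrow of R, so that R ⊆ ⌈ ⊥ → X ⌉ʳˡᵖ, while X ≰ x.
module Submission where

open import Defs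
open import Level using (Lift; lift; lower; _⊔_)
open import Data.Nat.Base using (ℕ; zero; suc; _*_)
open import Data.Fin.Base using (Fin; zero; suc; combine; remQuot)
open import Data.Fin.Properties using (any?; remQuot-combine)
open import Data.Fin.Induction using (po-wellFounded)
open import Data.Product.Base using (∃; ∃₂; Σ-syntax; _×_; _,_; proj₁; proj₂)
import Data.Product.Base as Product
open import Data.Sum.Base using (_⊎_; inj₁; inj₂; [_,_]′)
import Data.Sum.Base as Sum
open import Function.Base using (_∘_; id; flip)
open import Function.Bundles using (_⇔_; Inverse; mk⇔)
open import Induction.WellFounded using (Acc; acc; WellFounded; module Subrelation)
open import Relation.Nullary.Decidable using (Dec; yes; no; map′; _×-dec_; _⊎-dec_; ¬?)
open import Relation.Nullary.Negation using (¬_; contradiction)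
open import Relation.Unary using (Pred; Decidable; _∩_; _⊆_; _≐_)
open import Relation.Unary.Properties using (≐-sym; ≐-trans)
open import Relation.Binary.Core using (Rel; _⇒_)
open import Relation.Binary.Definitions using (Minimum; _Respects_)
  renaming (Decidable to Decidable₂)
open import Relation.Binary.Structures using (IsPartialOrder)
open import Relation.Binary.Lattice using (Lattice)
import Relation.Binary.Construct.NonStrictToStrict as ToStrict
import Relation.Binary.Construct.On as On
import Relation.Binary.Properties.Poset as PosetProperties
import Relation.Binary.Lattice.Properties.Lattice as LatticeProperties
import Relation.Binary.Lattice.Properties.JoinSemilattice as JoinProperties
import Relation.Binary.Lattice.Properties.MeetSemilattice as MeetProperties
open import Relation.Binary.PropositionalEquality using (cong)

-- Irreducible elements and finite families of generators.

module _ {c ℓ₁ ℓ₂} (L : Lattice c ℓ₁ ℓ₂) where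
  open Lattice L

  -- An index may satisfy Q in several ways; an upper bound of the family only has to
  -- be tested against one of them.
  J⇒∈-generators : ∀ {q} x → J L x → ∀ m {Q : Pred (Fin m) q} → Decidable Q →
    (f : ∀ i → Q i → Carrier) → (∀ i q → f i q ≤ x) →
    (∀ u → (∀ i → Q i → ∃ λ q → f i q ≤ u) → x ≤ u) →
    ∃₂ λ i q → x ≈ f i q
  J⇒∈-generators {q} x (x≰ , split) = go
    where
    -- `y` accumulates the join of the members already passed. It is always inhabited, so no bottom
    -- element is required; `go` starts it at the first member present.
    above : ∀ m {Q : Pred (Fin m) q} → Decidable Q →
      (f : ∀ i → Q i → Carrier) → (∀ i q → f i q ≤ x) → (y : Carrier) → y ≤ x →
      (∀ u → y ≤ u → (∀ i → Q i → ∃ λ q → f i q ≤ u) → x ≤ u) →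
      x ≈ y ⊎ ∃₂ λ i q → x ≈ f i q
    above zero Q? f f≤x y y≤x x≤ = inj₁ (antisym (x≤ y refl λ ()) y≤x)
    above (suc m) Q? f f≤x y y≤x x≤ with Q? zero
    ... | no ¬q₀ = Sum.map₂ (λ (i , r) → suc i , r)
      (above m (Q? ∘ suc) (f ∘ suc) (f≤x ∘ suc) y y≤x
        λ u y≤u h → x≤ u y≤u λ { zero q₀ → contradiction q₀ ¬q₀ ; (suc i) → h i })
    ... | yes q₀
      with above m (Q? ∘ suc) (f ∘ suc) (f≤x ∘ suc) (y ∨ f zero q₀)
        (∨-least y≤x (f≤x zero q₀))
        (λ u y∨f≤u h → x≤ u (trans (x≤x∨y _ _) y∨f≤u)
          λ { zero _ → q₀ , trans (y≤x∨y _ _) y∨f≤u ; (suc i) → h i })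
    ...   | inj₂ (i , r) = inj₂ (suc i , r)
    ...   | inj₁ x≈ = Sum.map₂ (λ e → zero , q₀ , e) (split _ _ x≈)

    go : ∀ m {Q : Pred (Fin m) q} → Decidable Q →
      (f : ∀ i → Q i → Carrier) → (∀ i q → f i q ≤ x) →
      (∀ u → (∀ i → Q i → ∃ λ q → f i q ≤ u) → x ≤ u) →
      ∃₂ λ i q → x ≈ f i q
    -- An empty family would make `x` the minimum.
    go zero Q? f f≤x x≤ = contradiction (λ u → x≤ u λ ()) x≰
    go (suc m) Q? f f≤x x≤ with Q? zero
    ... | no ¬q₀ = Product.map suc id (go m (Q? ∘ suc) (f ∘ suc) (f≤x ∘ suc)
      λ u h → x≤ u λ { zero q₀ → contradiction q₀ ¬q₀ ; (suc i) → h i })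
    ... | yes q₀ = [ (λ e → zero , q₀ , e) , (λ (i , r) → suc i , r) ]′
      (above m (Q? ∘ suc) (f ∘ suc) (f≤x ∘ suc) (f zero q₀) (f≤x zero q₀)
        λ u f≤u h → x≤ u λ { zero _ → q₀ , f≤u ; (suc i) → h i })

M⇒∈-generators : ∀ {c ℓ₁ ℓ₂} (L : Lattice c ℓ₁ ℓ₂) → let open Lattice L in
  ∀ {q} x → M L x → ∀ m {Q : Pred (Fin m) q} → Decidable Q →
  (f : ∀ i → Q i → Carrier) → (∀ i q → x ≤ f i q) →
  (∀ u → (∀ i → Q i → ∃ λ q → u ≤ f i q) → u ≤ x) →
  ∃₂ λ i q → x ≈ f i q
M⇒∈-generators L = J⇒∈-generators (LatticeProperties.∧-∨-lattice L)

-- Covers and well-founded descent in a finite lattice.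

module _ {c ℓ₁ ℓ₂} (L : Lattice c ℓ₁ ℓ₂) (finite : Finite L) where
  open Lattice L renaming (trans to ≤-trans; refl to ≤-refl)
  open TransferSystems L finite
  open ToStrict _≈_ _≤_ using (_<_)
  open JoinProperties joinSemilattice using (∨-monotonic)
  open MeetProperties meetSemilattice using (∧-monotonic)
  open PosetProperties poset using (≥-isPartialOrder)
  open Inverse (proj₂ finite) using (to; from; strictlyInverseʳ)

  private
    n : ℕ
    n = proj₁ finite

  infix 4 _<?_
  _<?_ : Decidable₂ _<_
  x <? y = (x ≤? y) ×-dec ¬? (x ≈? y)

  <-resp : ∀ {x x′ y y′} → x ≈ x′ → y ≈ y′ → x < y → x′ < y′
  <-resp p q (x≤y , x≉y) =
    ≤-resp p q x≤y , λ e → x≉y (Eq.trans p (Eq.trans e (Eq.sym q)))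

  ≤∧≱⇒< : ∀ {x y} → x ≤ y → ¬ y ≤ x → x < y
  ≤∧≱⇒< x≤y y≰x = x≤y , y≰x ∘ reflexive ∘ Eq.sym

  <⇒≱ : ∀ {x y} → x < y → ¬ y ≤ x
  <⇒≱ (x≤y , x≉y) y≤x = x≉y (antisym x≤y y≤x)

  ∃? : ∀ {p} {P : Pred Carrier p} → P Respects _≈_ → Decidable P → Dec (∃ P)
  ∃? r P? = map′ (λ (i , p) → from i , p)
                 (λ (x , p) → to x , r (Eq.sym (strictlyInverseʳ x)) p)
                 (any? (P? ∘ from))

  private
    -- Transported from `Fin n` along the enumeration. The order is a parameter so that both `_≤_`
    -- and its converse are covered.
    strict-wellFounded : ∀ {_≼_ : Rel Carrier ℓ₂} → IsPartialOrder _≈_ _≼_ →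
                         WellFounded (ToStrict._<_ _≈_ _≼_)
    strict-wellFounded {_≼_} po = Subrelation.wellFounded
      (λ (x≼y , x≉y) →
          IsPartialOrder.≤-respʳ-≈ po (inv⁻ _) (IsPartialOrder.≤-respˡ-≈ po (inv⁻ _) x≼y)
        , λ e → x≉y (Eq.trans (inv⁻ _) (Eq.trans e (strictlyInverseʳ _))))
      (On.wellFounded to (po-wellFounded (On.isPartialOrder from po)))
      where
      inv⁻ : ∀ x → x ≈ from (to x)
      inv⁻ x = Eq.sym (strictlyInverseʳ x)

  <-wellFounded : WellFounded _<_
  <-wellFounded = strict-wellFounded isPartialOrder

  <-noetherian : WellFounded (ToStrict._<_ _≈_ (flip _≤_))
  <-noetherian = strict-wellFounded ≥-isPartialOrder

  minimal : ∀ {q} {Q : Pred Carrier q} → Q Respects _≈_ → Decidable Q → ∀ {y} → Q y →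
            ∃ λ z → z ≤ y × Q z × (∀ {w} → Q w → w ≤ z → z ≤ w)
  minimal {Q = Q} r Q? = go (<-wellFounded _)
    where
    go : ∀ {y} → Acc _<_ y → Q y → ∃ λ z → z ≤ y × Q z × (∀ {w} → Q w → w ≤ z → z ≤ w)
    go {y} (acc rs) qy
      with ∃? (λ e (qw , w<y) → r e qw , <-resp e Eq.refl w<y) (λ w → Q? w ×-dec (w <? y))
    ... | yes (w , qw , w<y) =
      let z , z≤w , rest = go (rs w<y) qw in z , ≤-trans z≤w (proj₁ w<y) , rest
    ... | no none = y , ≤-refl , qy , λ {w} qw w≤y → y≤ qw w≤y
      where
      y≤ : ∀ {w} → Q w → w ≤ y → y ≤ w
      y≤ {w} qw w≤y with w ≈? y
      ... | yes e  = reflexive (Eq.sym e)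
      ... | no w≉y = contradiction (w , qw , w≤y , w≉y) none

  ∃-cover : ∀ {x y} → x < y → ∃ λ w → x ⋖ w × w ≤ y
  ∃-cover {x} x<y =
    let w , w≤y , x<w , least = minimal (<-resp Eq.refl) (x <?_) x<y
    in w , (x<w , λ (v , x<v , v<w) → <⇒≱ v<w (least x<v (proj₁ v<w))) , w≤y

  ⋖-resp : ∀ {x x′ y y′} → x ≈ x′ → y ≈ y′ → x ⋖ y → x′ ⋖ y′
  ⋖-resp p q (x<y , none) = <-resp p q x<y , λ (z , x<z , z<y) →
    none (z , <-resp (Eq.sym p) Eq.refl x<z , <-resp Eq.refl (Eq.sym q) z<y)

  _⋖?_ : Decidable₂ _⋖_
  x ⋖? y = (x <? y) ×-dec ¬? (∃?
    (λ e (x<z , z<y) → <-resp Eq.refl e x<z , <-resp e Eq.refl z<y)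
    (λ z → (x <? z) ×-dec (z <? y)))

  ⋖-between : ∀ {x y z} → x ⋖ y → x ≤ z → z ≤ y → z ≤ x ⊎ y ≤ z
  ⋖-between {x} {y} {z} (_ , none) x≤z z≤y with z ≤? x | y ≤? z
  ... | yes z≤x | _       = inj₁ z≤x
  ... | no _    | yes y≤z = inj₂ y≤z
  ... | no z≰x  | no y≰z  = contradiction (z , ≤∧≱⇒< x≤z z≰x , ≤∧≱⇒< z≤y y≰z) none

  fromRelation : {Q : Rel Carrier ℓ₂} → Q ⇒ _≤_ →
                 (∀ {x x′ y y′} → x ≈ x′ → y ≈ y′ → Q x y → Q x′ y′) →
                 Decidable₂ Q → ArrowSet
  fromRelation {Q} Q⇒≤ r Q? = record
    { Arr     = λ x y → Lift (c ⊔ ℓ₁ ⊔ ℓ₂) (Q x y)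
    ; refines = Q⇒≤ ∘ lower
    ; resp    = (λ e (lift q) → lift (r Eq.refl e q)) , (λ e (lift q) → lift (r e Eq.refl q))
    ; arr?    = λ x y → map′ lift lower (Q? x y)
    }

  -- Restriction, saturation and principal transfer systems.

  module _ {R : ArrowSet} (T : IsTransferSystem R) where
    open IsTransferSystem T using (restrict)
    private module R = IsPartialOrder (IsTransferSystem.isPartialOrder T)

    ⟶-refl : ∀ {x} → R ∋ x ⟶ x
    ⟶-refl = R.reflexive Eq.refl

    restrict-≤ : ∀ {x y z} → R ∋ x ⟶ y → x ≤ z → z ≤ y → R ∋ x ⟶ z
    restrict-≤ a x≤z z≤y =
      arr-resp R (antisym (x∧y≤x _ _) (∧-greatest ≤-refl x≤z)) Eq.refl (restrict a z≤y)

    restrict-dominated : ∀ {a b x y} → R ∋ a ⟶ b → a ∧ y ≈ x → y ≤ b → R ∋ x ⟶ y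
    restrict-dominated a→b e y≤b = arr-resp R e Eq.refl (restrict a→b y≤b)

    -- Transitivity and restriction supply the last two clauses of `Saturated`. In the first,
    -- tightness makes `y → z` either `x → z` again or an identity.
    saturated⁺ : (∀ {x y z} → R ∋ x ⟶ z → x ≤ y → y ≤ z → y ≤ x ⊎ z ≤ y) → Saturated R
    saturated⁺ tight x y z x≤y y≤z =
        (λ _ x→z → [ (λ y≤x → arr-resp R (antisym x≤y y≤x) Eq.refl x→z)
                   , (λ z≤y → R.reflexive (antisym y≤z z≤y)) ]′ (tight x→z x≤y y≤z))
      , R.trans
      , (λ x→z _ → restrict-≤ x→z x≤y y≤z)

    module _ (sat : Saturated R) where

      saturated-≤ : ∀ {x y z} → R ∋ x ⟶ z → x ≤ y → y ≤ z → R ∋ y ⟶ z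
      saturated-≤ x→z x≤y y≤z = proj₁ (sat _ _ _ x≤y y≤z) (restrict-≤ x→z x≤y y≤z) x→z

      -- Splits off a cover `x ⋖ w` with `w ≤ y` at the source of `x → y`; saturation gives `w → y`,
      -- and the recursion ends because its source climbs.
      covers-generate : ∀ {S} → IsTransferSystem S →
                        (∀ {x y} → x ⋖ y → R ∋ x ⟶ y → S ∋ x ⟶ y) → R ⊑ S
      covers-generate {S} S-tr covers = go (<-noetherian _)
        where
        module S = IsPartialOrder (IsTransferSystem.isPartialOrder S-tr)

        go : ∀ {x y} → Acc (ToStrict._<_ _≈_ (flip _≤_)) x → R ∋ x ⟶ y → S ∋ x ⟶ y
        go {x} {y} (acc rs) x→y with x ≈? y
        ... | yes e  = S.reflexive e
        ... | no x≉y =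
          let w , x⋖w , w≤y = ∃-cover (refines R x→y , x≉y)
              x≤w = ⋖⇒≤ x⋖w
              w≉x = proj₂ (proj₁ x⋖w) ∘ Eq.sym
          in S.trans (covers x⋖w (restrict-≤ x→y x≤w w≤y))
                     (go (rs (x≤w , w≉x)) (saturated-≤ x→y x≤w w≤y))

  ⌊⌋-isTransferSystem : ∀ {x y} (x≤y : x ≤ y) → IsTransferSystem ⌊ x≤y ⌋
  ⌊⌋-isTransferSystem x≤y = proj₁ (proj₁ (⌊⌋-smallest x≤y))

  ⌊⌋-∋ : ∀ {x y} (x≤y : x ≤ y) → ⌊ x≤y ⌋ ∋ x ⟶ y
  ⌊⌋-∋ x≤y = proj₂ (proj₁ (⌊⌋-smallest x≤y))

  -- `Q` defines a transfer system containing `x → y`, hence contains the smallest one. It may be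
  -- strictly larger. The alternative `b ≤ a` accounts for identities.
  ⌊⌋-bound : ∀ {x y} (x≤y : x ≤ y) {a b} → ⌊ x≤y ⌋ ∋ a ⟶ b → x ∧ b ≤ a × (b ≤ a ⊎ b ≤ y)
  ⌊⌋-bound {x} {y} x≤y a→b =
    proj₂ (lower (proj₂ (⌊⌋-smallest x≤y) {G} (G-isTransferSystem , lift G∋x⟶y) a→b))
    where
    Q : Rel Carrier ℓ₂
    Q a b = a ≤ b × x ∧ b ≤ a × (b ≤ a ⊎ b ≤ y)

    G : ArrowSet
    G = fromRelation {Q} proj₁
      (λ p q (a≤b , x∧b≤a , s) →
        ≤-resp p q a≤b , ≤-resp (∧-resp Eq.refl q) p x∧b≤a
        , Sum.map (≤-resp q p) (≤-resp q Eq.refl) s)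
      (λ a b → (a ≤? b) ×-dec (((x ∧ b) ≤? a) ×-dec ((b ≤? a) ⊎-dec (b ≤? y))))

    G∋x⟶y : Q x y
    G∋x⟶y = x≤y , x∧y≤x _ _ , inj₂ ≤-refl

    G-isTransferSystem : IsTransferSystem G
    G-isTransferSystem = record
      { isPartialOrder = isPartialOrder⁺ G
          (λ a b e → lift (reflexive e , ≤-trans (x∧y≤y _ _) (≈⇒≥ e) , inj₁ (≈⇒≥ e)))
          (λ a b d (lift (a≤b , x∧b≤a , s)) (lift (b≤d , x∧d≤b , t)) → lift
            ( ≤-trans a≤b b≤d
            , ≤-trans (∧-greatest (x∧y≤x _ _) x∧d≤b) x∧b≤a
            , ([ (λ d≤b → Sum.map (≤-trans d≤b) (≤-trans d≤b) s) , inj₂ ]′ t)))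
      ; restrict = λ (lift (a≤b , x∧b≤a , s)) z≤b → lift
          ( x∧y≤y _ _
          , ∧-greatest (≤-trans (∧-monotonic ≤-refl z≤b) x∧b≤a) (x∧y≤y _ _)
          , Sum.map (λ b≤a → ∧-greatest (≤-trans z≤b b≤a) ≤-refl) (≤-trans z≤b) s)
      }
      where
      ≈⇒≥ : ∀ {a b} → a ≈ b → b ≤ a
      ≈⇒≥ = reflexive ∘ Eq.sym

  -- The transfer system generated by a cover.

  module Covers (modular : Modular L) {H K} (H⋖K : H ⋖ K) where

    H≤K : H ≤ K
    H≤K = ⋖⇒≤ H⋖K

    K≰H : ¬ K ≤ H
    K≰H = <⇒≱ (proj₁ H⋖K)

    -- For a nontrivial arrow, `y ∨ H` lies between `H` and `K`, so it is one of them. If `H`, then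
    -- `y ≤ H ∧ z ≤ x`. If `K`, the modular law gives `z ≤ (y ∨ H) ∧ z ≈ y ∨ (H ∧ z) ≤ y`.
    ⌊⋖⌋-tight : ∀ {x y z} → ⌊ H≤K ⌋ ∋ x ⟶ z → x ≤ y → y ≤ z → y ≤ x ⊎ z ≤ y
    ⌊⋖⌋-tight {x} {y} {z} x→z x≤y y≤z with ⌊⌋-bound H≤K x→z
    ... | _     , inj₁ z≤x = inj₁ (≤-trans y≤z z≤x)
    ... | H∧z≤x , inj₂ z≤K =
      Sum.map (λ y∨H≤H → ≤-trans (∧-greatest (≤-trans (x≤x∨y _ _) y∨H≤H) y≤z) H∧z≤x)
              (λ K≤y∨H → ≤-trans (∧-greatest (≤-trans z≤K K≤y∨H) ≤-refl)
                         (≤-trans (reflexive (Eq.sym (modular y H z y≤z)))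
                           (∨-least ≤-refl (≤-trans H∧z≤x x≤y))))
              (⋖-between H⋖K (y≤x∨y _ _) (∨-least (≤-trans y≤z z≤K) H≤K))

    ⊑⌊⋖⌋⇒saturated : ∀ {R} → IsTransferSystem R → R ⊑ ⌊ H≤K ⌋ → IsSaturatedTransferSystem R
    ⊑⌊⋖⌋⇒saturated T R⊑ = T , saturated⁺ T (⌊⋖⌋-tight ∘ R⊑)

    ⌊⋖⌋-isSaturated : IsSaturatedTransferSystem ⌊ H≤K ⌋
    ⌊⋖⌋-isSaturated = ⊑⌊⋖⌋⇒saturated (⌊⌋-isTransferSystem H≤K) id

    -- By `⌊⌋-bound`, only `H → K` is removed, up to `_≈_`; the inequalities express this in a form
    -- that is easy to test on composites and restrictions.
    ⌊⋖⌋⁻ : ArrowSet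
    ⌊⋖⌋⁻ = record
      { Arr     = λ a b → ⌊ H≤K ⌋ ∋ a ⟶ b × ¬ (a ≤ H × K ≤ b)
      ; refines = refines ⌊ H≤K ⌋ ∘ proj₁
      ; resp    = rsp Eq.refl , (λ p → rsp p Eq.refl)
      ; arr?    = λ a b → arr? ⌊ H≤K ⌋ a b ×-dec ¬? ((a ≤? H) ×-dec (K ≤? b))
      }
      where
      rsp : ∀ {a a′ b b′} → a ≈ a′ → b ≈ b′ →
            ⌊ H≤K ⌋ ∋ a ⟶ b × ¬ (a ≤ H × K ≤ b) → ⌊ H≤K ⌋ ∋ a′ ⟶ b′ × ¬ (a′ ≤ H × K ≤ b′)
      rsp p q (a→b , ¬d) = arr-resp ⌊ H≤K ⌋ p q a→b , λ (a≤H , K≤b) →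
        ¬d (≤-respˡ-≈ (Eq.sym p) a≤H , ≤-respʳ-≈ (Eq.sym q) K≤b)

    ⌊⋖⌋⁻-∌ : ¬ ⌊⋖⌋⁻ ∋ H ⟶ K
    ⌊⋖⌋⁻-∌ (_ , ¬d) = ¬d (≤-refl , ≤-refl)

    -- If a composite were removed, `middle` would place its midpoint below `H` or above `K`, so one
    -- factor was removed already. For a restriction, either `a → b` was removed already or
    -- `K ≤ a ∧ z ≤ H`.
    ⌊⋖⌋⁻-isTransferSystem : IsTransferSystem ⌊⋖⌋⁻
    ⌊⋖⌋⁻-isTransferSystem = record
      { isPartialOrder = isPartialOrder⁺ ⌊⋖⌋⁻
          (λ x y e → F.reflexive e , λ (x≤H , K≤y) →
            K≰H (≤-trans K≤y (≤-respˡ-≈ e x≤H)))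
          (λ u v w (u→v , ¬uv) (v→w , ¬vw) → F.trans u→v v→w , λ (u≤H , K≤w) →
            middle v→w K≤w (λ v≤H → ¬vw (v≤H , K≤w)) (λ K≤v → ¬uv (u≤H , K≤v)))
      ; restrict = λ (a→b , ¬ab) z≤b →
            IsTransferSystem.restrict (⌊⌋-isTransferSystem H≤K) a→b z≤b
          , λ (a∧z≤H , K≤z) →
              middle a→b (≤-trans K≤z z≤b) (λ a≤H → ¬ab (a≤H , ≤-trans K≤z z≤b))
                (λ K≤a → K≰H (≤-trans (∧-greatest K≤a K≤z) a∧z≤H))
      }
      where
      module F = IsPartialOrder (IsTransferSystem.isPartialOrder (⌊⌋-isTransferSystem H≤K))

      -- A nontrivial arrow has `H ≤ v ≤ K` by `⌊⌋-bound`, and the cover leaves only the two ends; a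
      -- trivial one has `K ≤ w ≤ v`.
      middle : ∀ {v w} → ⌊ H≤K ⌋ ∋ v ⟶ w → K ≤ w → ¬ v ≤ H → ¬ ¬ K ≤ v
      middle v→w K≤w v≰H K≰v with ⌊⌋-bound H≤K v→w
      ... | _     , inj₁ w≤v = K≰v (≤-trans K≤w w≤v)
      ... | H∧w≤v , inj₂ w≤K =
        [ v≰H , K≰v ]′ (⋖-between H⋖K
          (≤-trans (∧-greatest ≤-refl (≤-trans H≤K K≤w)) H∧w≤v)
          (≤-trans (refines ⌊ H≤K ⌋ v→w) w≤K))

    ⌊⋖⌋⁻-isSaturated : IsSaturatedTransferSystem ⌊⋖⌋⁻
    ⌊⋖⌋⁻-isSaturated = ⊑⌊⋖⌋⇒saturated ⌊⋖⌋⁻-isTransferSystem proj₁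

    -- An arrow `a → b` of `R` with `a ≤ H` and `K ≤ b` satisfies `a ∧ K ≈ H`, so restricting it to
    -- `K` would put `H → K` in `R`.
    ⊑⌊⋖⌋⁻ : ∀ {R} → IsTransferSystem R → R ⊑ ⌊ H≤K ⌋ → ¬ R ∋ H ⟶ K → R ⊑ ⌊⋖⌋⁻
    ⊑⌊⋖⌋⁻ T R⊑ ∌ a→b = R⊑ a→b , λ (a≤H , K≤b) → ∌ (restrict-dominated T a→b
      (antisym (≤-trans (x∧y≤x _ _) a≤H)
        (∧-greatest (≤-trans (∧-greatest ≤-refl (≤-trans H≤K K≤b)) (proj₁ (⌊⌋-bound H≤K (R⊑ a→b)))) H≤K))
      K≤b)

  -- Right lifting classes of principal cotransfer systems.

  module _ (⊥ : Carrier) (⊥-min : Minimum _≤_ ⊥) where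

    N : Carrier → ArrowSet
    N X = ⌈ ⊥-min X ⌉ ʳˡᵖ

    N⁻ : ∀ {X x y} → N X ∋ x ⟶ y → X ≤ y → X ≤ x
    N⁻ {X} (_ , lifts) = lifts ⊥ X (proj₂ (proj₁ (⌈⌉-smallest (⊥-min X)))) (⊥-min _)

    -- `C` is the cotransfer system of identities and arrows `a → X ∨ a`, written with inequalities.
    -- Against such an arrow, `X ≤ y` forces `X ≤ x`, hence `X ∨ a ≤ x`.
    N⁺ : ∀ {X x y} → x ≤ y → (X ≤ y → X ≤ x) → N X ∋ x ⟶ y
    N⁺ {X} {x} {y} x≤y h = x≤y , λ a b a→b a≤x b≤y →
      [ (λ b≤a → ≤-trans b≤a a≤x)
      , (λ (X≤b , b≤X∨a) → ≤-trans b≤X∨a (∨-least (h (≤-trans X≤b b≤y)) a≤x))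
      ]′ (proj₂ (lower (proj₂ (⌈⌉-smallest (⊥-min X)) {C} (C-isCotransferSystem , lift C∋⊥⟶X) a→b)))
      where
      Q : Rel Carrier ℓ₂
      Q a b = a ≤ b × (b ≤ a ⊎ (X ≤ b × b ≤ X ∨ a))

      C : ArrowSet
      C = fromRelation {Q} proj₁
        (λ p q (a≤b , s) → ≤-resp p q a≤b
          , Sum.map (≤-resp q p)
              (Product.map (≤-respʳ-≈ q) (≤-resp q (∨-resp Eq.refl p))) s)
        (λ a b → (a ≤? b) ×-dec ((b ≤? a) ⊎-dec ((X ≤? b) ×-dec (b ≤? (X ∨ a)))))

      C∋⊥⟶X : Q ⊥ X
      C∋⊥⟶X = ⊥-min X , inj₂ (≤-refl , x≤x∨y _ _)

      C-trans : ∀ {a b d} → Q a b → Q b d → Q a d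
      C-trans (a≤b , s) (b≤d , inj₁ d≤b) = ≤-trans a≤b b≤d ,
        Sum.map (≤-trans d≤b) (λ (X≤b , b≤) → ≤-trans X≤b b≤d , ≤-trans d≤b b≤) s
      C-trans (a≤b , s) (b≤d , inj₂ (X≤d , d≤)) = ≤-trans a≤b b≤d , inj₂ (X≤d ,
        ≤-trans d≤ (∨-least (x≤x∨y _ _) ([ (λ b≤a → ≤-trans b≤a (y≤x∨y _ _)) , proj₂ ]′ s)))

      C-isCotransferSystem : IsCotransferSystem C
      C-isCotransferSystem = record
        { isPartialOrder = isPartialOrder⁺ C
            (λ _ _ e → lift (reflexive e , inj₁ (reflexive (Eq.sym e))))
            (λ _ _ _ (lift p) (lift q) → lift (C-trans p q))
        ; corestrict = λ (lift (a≤b , s)) a≤z → lift (y≤x∨y _ _ ,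
            Sum.map (λ b≤a → ∨-least (≤-trans b≤a a≤z) ≤-refl)
              (λ (X≤b , b≤) → ≤-trans X≤b (x≤x∨y _ _)
                , ∨-least (≤-trans b≤ (∨-monotonic ≤-refl a≤z)) (y≤x∨y _ _)) s)
        }

    N-isSaturated : ∀ X → IsSaturatedTransferSystem (N X)
    N-isSaturated X = record
      { isPartialOrder = isPartialOrder⁺ (N X)
          (λ _ _ e → N⁺ (reflexive e) (≤-respʳ-≈ (Eq.sym e)))
          (λ _ _ _ a b → N⁺ (≤-trans (refines (N X) a) (refines (N X) b)) (N⁻ a ∘ N⁻ b))
      ; restrict = λ a z≤y → N⁺ (x∧y≤y _ _) λ X≤z →
          ∧-greatest (N⁻ a (≤-trans X≤z z≤y)) X≤z
      } , λ _ _ _ x≤y y≤z →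
          (λ _ b → N⁺ y≤z λ X≤z → ≤-trans (N⁻ b X≤z) x≤y)
        , (λ a b → N⁺ (≤-trans x≤y y≤z) (N⁻ a ∘ N⁻ b))
        , (λ a _ → N⁺ x≤y λ X≤y → N⁻ a (≤-trans X≤y y≤z))

    -- Suppose `x → y` is in `R` with `X ≤ y` but not `X ≤ x`. Then `⊥ → x ∧ X` lies in `N X`, hence
    -- in `R`, and composes with the restriction `x ∧ X → X` to give `⊥ → X`.
    ⊑N : ∀ {X R} → IsTransferSystem R → N X ⊑ R → ¬ R ∋ ⊥ ⟶ X → R ⊑ N X
    ⊑N {X} {R} T N⊑R ∌ {x} {y} x→y = N⁺ (refines R x→y) X≤x
      where
      open IsTransferSystem T using (restrict)
      module R = IsPartialOrder (IsTransferSystem.isPartialOrder T)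

      X≤x : X ≤ y → X ≤ x
      X≤x X≤y with X ≤? x
      ... | yes p  = p
      ... | no X≰x = contradiction
        (R.trans
          (N⊑R (N⁺ (⊥-min (x ∧ X)) λ X≤x∧X → contradiction (≤-trans X≤x∧X (x∧y≤x _ _)) X≰x))
          (restrict x→y X≤y)) ∌

    ⊥∉N : ∀ {X} → ¬ (X ≈ ⊥) → ¬ N X ∋ ⊥ ⟶ X
    ⊥∉N X≉⊥ ⊥→X = X≉⊥ (antisym (N⁻ ⊥→X ≤-refl) (⊥-min _))

    N⊥-full : ∀ {x y} → x ≤ y → N ⊥ ∋ x ⟶ y
    N⊥-full x≤y = N⁺ x≤y λ _ → ⊥-min _

    -- Take `z` minimal with `z → y` in `R`. An arrow `a → b` of `R` with `z ≤ b` restricts to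
    -- `a ∧ z → z`, so minimality gives `z ≤ a`; thus `R ⊑ N z`. The hypothesis then yields `z ≤ x`,
    -- and saturation moves the source of `z → y` up to `x`.
    N-separates : ∀ {R x y} → IsSaturatedTransferSystem R → x ≤ y →
      (∀ z → ¬ (z ≈ ⊥) → R ⊑ N z → z ≤ y → z ≤ x) → R ∋ x ⟶ y
    N-separates {R} {x} {y} (T , sat) x≤y h = saturated-≤ T sat z→y z≤x x≤y
      where
      open IsTransferSystem T using (restrict)
      module R = IsPartialOrder (IsTransferSystem.isPartialOrder T)

      least : ∃ λ z → z ≤ y × R ∋ z ⟶ y × (∀ {w} → R ∋ w ⟶ y → w ≤ z → z ≤ w)
      least = minimal (λ e → arr-resp R e Eq.refl) (λ z → arr? R z y) (⟶-refl T)

      z : Carrier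
      z = proj₁ least

      z→y : R ∋ z ⟶ y
      z→y = proj₁ (proj₂ (proj₂ least))

      z≤x : z ≤ x
      z≤x with z ≈? ⊥
      -- The hypothesis excludes `⊥`, for which `z ≤ x` is immediate.
      ... | yes z≈⊥ = ≤-respˡ-≈ (Eq.sym z≈⊥) (⊥-min x)
      ... | no z≉⊥  = h z z≉⊥
        (λ a→b → N⁺ (refines R a→b) λ z≤b → ≤-trans
          (proj₂ (proj₂ (proj₂ least))
            (R.trans (restrict a→b z≤b) z→y) (x∧y≤y _ _))
          (x∧y≤x _ _))
        (proj₁ (proj₂ least))

    CoverSystem : Pred ArrowSet (c ⊔ ℓ₁ ⊔ ℓ₂)
    CoverSystem R = ∃₂ λ H K → Σ[ H⋖K ∈ H ⋖ K ] ⌊ ⋖⇒≤ H⋖K ⌋ ≋ R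

    LiftingSystem : Pred ArrowSet (c ⊔ ℓ₁ ⊔ ℓ₂)
    LiftingSystem R = ∃ λ X → ¬ (X ≈ ⊥) × N X ≋ R

    -- Irreducibles in lattices between `Sat` and `Tr`.

    module Irreducibles
        (modular : Modular L)
        {P : Pred ArrowSet (c ⊔ ℓ₁ ⊔ ℓ₂)} (P? : Decidable P) (closed : IntersectionClosed P)
        (P⊆Tr : P ⊆ IsTransferSystem) (Sat⊆P : IsSaturatedTransferSystem ⊆ P) where

      -- `P` will be both `IsTransferSystem` and `IsSaturatedTransferSystem`. The joins may differ,
      -- so they enter only through their universal property.
      𝕃 : Lattice _ _ _
      𝕃 = containmentLattice P? closed

      module 𝕃 = Lattice 𝕃

      saturated-≋ : ∀ {R S} → R ≋ S → IsSaturatedTransferSystem S → IsSaturatedTransferSystem R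
      saturated-≋ (R⊑S , S⊑R) =
        ≋-closed isSaturatedTransferSystem-closed (S⊑R , R⊑S)

      -- By `covers-generate`, `R` is the join in `𝕃` of the systems generated by its covers, so
      -- irreducibility makes it one of them.
      J⇒cover : ∀ T → J 𝕃 T → IsSaturatedTransferSystem (proj₁ T) → CoverSystem (proj₁ T)
      J⇒cover T@(R , _) T∈J (R-tr , R-sat) =
        let k , (cover , _) , R⊑ , ⊑R = J⇒∈-generators 𝕃 T T∈J (n * n) Q?
              (λ k (cover , _) → ⌊ ⋖⇒≤ cover ⌋ , Sat⊆P (Covers.⌊⋖⌋-isSaturated modular cover))
              (λ k (cover , a) → proj₂ (⌊⌋-smallest (⋖⇒≤ cover)) (R-tr , a))
              bound
        in _ , _ , cover , ⊑R , R⊑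
        where
        lo hi : Fin (n * n) → Carrier
        lo = from ∘ proj₁ ∘ remQuot {n} n
        hi = from ∘ proj₂ ∘ remQuot {n} n

        Q : Pred (Fin (n * n)) _
        Q k = lo k ⋖ hi k × R ∋ lo k ⟶ hi k

        Q? : Decidable Q
        Q? k = (lo k ⋖? hi k) ×-dec arr? R (lo k) (hi k)

        bound : ∀ U → (∀ k → Q k → ∃ λ q → ⌊ ⋖⇒≤ (proj₁ q) ⌋ ⊑ proj₁ U) → R ⊑ proj₁ U
        bound (U , u) h = covers-generate R-tr R-sat (P⊆Tr u) λ {x} {y} x⋖y x→y →
          -- Decoding `k` returns `x` and `y` only up to `_≈_`, hence the transports.
          let k = combine (to x) (to y)
              e = remQuot-combine (to x) (to y)
              lo≈ = Eq.trans (Eq.reflexive (cong (from ∘ proj₁) e)) (strictlyInverseʳ x)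
              hi≈ = Eq.trans (Eq.reflexive (cong (from ∘ proj₂) e)) (strictlyInverseʳ y)
              (cover , _) , ⌊⌋⊑U = h k
                ( ⋖-resp (Eq.sym lo≈) (Eq.sym hi≈) x⋖y
                , arr-resp R (Eq.sym lo≈) (Eq.sym hi≈) x→y)
          in arr-resp U lo≈ hi≈ (⌊⌋⊑U (⌊⌋-∋ (⋖⇒≤ cover)))

      -- If neither joinand contains `H → K`, both lie in `⌊⋖⌋⁻`, hence so does their join, which
      -- must contain `H → K`.
      cover⇒J : ∀ {H K} (H⋖K : H ⋖ K) →
        J 𝕃 (⌊ ⋖⇒≤ H⋖K ⌋ , Sat⊆P (Covers.⌊⋖⌋-isSaturated modular H⋖K))
      cover⇒J {H} {K} H⋖K =
          (λ min → ⌊⋖⌋⁻-∌ (min (⌊⋖⌋⁻ , Sat⊆P ⌊⋖⌋⁻-isSaturated) (⌊⌋-∋ H≤K)))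
        , split
        where
        open Covers modular H⋖K

        split : ∀ A B → ⌊ H≤K ⌋ ≋ proj₁ (A 𝕃.∨ B) → ⌊ H≤K ⌋ ≋ proj₁ A ⊎ ⌊ H≤K ⌋ ≋ proj₁ B
        split A@(R , r) B@(S , s) (⊑∨ , ∨⊑) with arr? R H K | arr? S H K
        ... | yes a | _ = inj₁ (proj₂ (⌊⌋-smallest H≤K) (P⊆Tr r , a) , ∨⊑ ∘ 𝕃.x≤x∨y A B)
        ... | no _ | yes b = inj₂ (proj₂ (⌊⌋-smallest H≤K) (P⊆Tr s , b) , ∨⊑ ∘ 𝕃.y≤x∨y A B)
        ... | no ¬a | no ¬b = contradiction
          (𝕃.∨-least {A} {B} {⌊⋖⌋⁻ , Sat⊆P ⌊⋖⌋⁻-isSaturated}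
            (⊑⌊⋖⌋⁻ (P⊆Tr r) (∨⊑ ∘ 𝕃.x≤x∨y A B) ¬a)
            (⊑⌊⋖⌋⁻ (P⊆Tr s) (∨⊑ ∘ 𝕃.y≤x∨y A B) ¬b)
            (⊑∨ (⌊⌋-∋ H≤K)))
          ⌊⋖⌋⁻-∌

      J∩Sat≐covers : ⟪ J 𝕃 ⟫ ∩ IsSaturatedTransferSystem ≐ CoverSystem
      J∩Sat≐covers =
          (λ ((T , T∈J , T≋R@(T⊑R , R⊑T)) , sat) →
            let H , K , H⋖K , ⌊⌋⊑T , T⊑⌊⌋ = J⇒cover T T∈J (saturated-≋ T≋R sat)
            in H , K , H⋖K , T⊑R ∘ ⌊⌋⊑T , T⊑⌊⌋ ∘ R⊑T)
        , (λ (H , K , H⋖K , ⌊⌋⊑R , R⊑⌊⌋) →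
            ((_ , Sat⊆P (Covers.⌊⋖⌋-isSaturated modular H⋖K)) , cover⇒J H⋖K , ⌊⌋⊑R , R⊑⌊⌋)
            , saturated-≋ (R⊑⌊⌋ , ⌊⌋⊑R) (Covers.⌊⋖⌋-isSaturated modular H⋖K))

      -- `N-separates` exhibits `R` as the meet of the `N z` above it with `z` not `⊥`, so
      -- irreducibility makes it one of them.
      M⇒lifting : ∀ T → M 𝕃 T → IsSaturatedTransferSystem (proj₁ T) → LiftingSystem (proj₁ T)
      M⇒lifting T@(R , _) T∈M sat =
        let k , (k≉⊥ , _) , R⊑ , ⊑R = M⇒∈-generators 𝕃 T T∈M n Q?
              (λ k _ → N (from k) , Sat⊆P (N-isSaturated (from k)))
              (λ _ → proj₂)
              bound
        in from k , k≉⊥ , ⊑R , R⊑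
        where
        Q : Pred (Fin n) _
        Q k = ¬ (from k ≈ ⊥) × R ⊑ N (from k)

        Q? : Decidable Q
        Q? k = ¬? (from k ≈? ⊥) ×-dec (R ⊑? N (from k))

        bound : ∀ U → (∀ k → Q k → ∃ λ (_ : Q k) → proj₁ U ⊑ N (from k)) → proj₁ U ⊑ R
        bound (U , _) h x→y = N-separates sat (refines U x→y) λ z z≉⊥ R⊑Nz z≤y →
          let z≈ = strictlyInverseʳ z
              _ , U⊑N = h (to z)
                ( (λ e → z≉⊥ (Eq.trans (Eq.sym z≈) e))
                , λ a→b → N⁺ (refines R a→b)
                    (≤-respˡ-≈ (Eq.sym z≈) ∘ N⁻ (R⊑Nz a→b) ∘ ≤-respˡ-≈ z≈))
          in ≤-respˡ-≈ z≈ (N⁻ (U⊑N x→y) (≤-respˡ-≈ (Eq.sym z≈) z≤y))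

      lifting⇒M : ∀ {X} → ¬ (X ≈ ⊥) → M 𝕃 (N X , Sat⊆P (N-isSaturated X))
      lifting⇒M {X} X≉⊥ =
          -- `N ⊥` contains every arrow, so it witnesses that `N X` is not the maximum.
          (λ max → ⊥∉N X≉⊥ (max (N ⊥ , Sat⊆P (N-isSaturated ⊥)) (N⊥-full (⊥-min X))))
        , split
        where
        split : ∀ A B → N X ≋ proj₁ (A 𝕃.∧ B) → N X ≋ proj₁ A ⊎ N X ≋ proj₁ B
        split (R , r) (S , s) (⊑∧ , ∧⊑) with arr? R ⊥ X | arr? S ⊥ X
        -- A factor missing `⊥ → X` is squeezed onto `N X` by `⊑N`; the two factors cannot both
        -- contain that arrow.
        ... | no ¬a | _     = inj₁ (proj₁ ∘ ⊑∧ , ⊑N (P⊆Tr r) (proj₁ ∘ ⊑∧) ¬a)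
        ... | yes _ | no ¬b = inj₂ (proj₂ ∘ ⊑∧ , ⊑N (P⊆Tr s) (proj₂ ∘ ⊑∧) ¬b)
        ... | yes a | yes b = contradiction (∧⊑ (a , b)) (⊥∉N X≉⊥)

      M∩Sat≐lifting : ⟪ M 𝕃 ⟫ ∩ IsSaturatedTransferSystem ≐ LiftingSystem
      M∩Sat≐lifting =
          (λ ((T , T∈M , T≋R@(T⊑R , R⊑T)) , sat) →
            let X , X≉⊥ , N⊑T , T⊑N = M⇒lifting T T∈M (saturated-≋ T≋R sat)
            in X , X≉⊥ , T⊑R ∘ N⊑T , T⊑N ∘ R⊑T)
        , (λ (X , X≉⊥ , N⊑R , R⊑N) →
            ((_ , Sat⊆P (N-isSaturated X)) , lifting⇒M X≉⊥ , N⊑R , R⊑N)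
            , saturated-≋ (R⊑N , N⊑R) (N-isSaturated X))

    ⟪⟫-∩-Sat : ∀ {q} {X : Pred (∃ IsSaturatedTransferSystem) q} →
               ⟪ X ⟫ ≐ ⟪ X ⟫ ∩ IsSaturatedTransferSystem
    ⟪⟫-∩-Sat =
      (λ r@((T , t) , _ , T≋R) → r , ≋-closed isSaturatedTransferSystem-closed T≋R t) , proj₁

    -- Since `N X` is a transfer system, only the arrow `H → K` has to be tested: `X ≤ K` must imply
    -- `X ≤ H`. Decidability of `_≤_` turns this into a disjunction.
    ⌊⋖⌋⊑N⇔ : ∀ {H K X} (H⋖K : H ⋖ K) → (⌊ ⋖⇒≤ H⋖K ⌋ ⊑ N X) ⇔ (¬ (X ≤ K) ⊎ X ≤ H)
    ⌊⋖⌋⊑N⇔ {H} {K} {X} H⋖K = mk⇔ cases λ s →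
      proj₂ (⌊⌋-smallest (⋖⇒≤ H⋖K)) (proj₁ (N-isSaturated X) ,
        N⁺ (⋖⇒≤ H⋖K) λ X≤K → [ contradiction X≤K , id ]′ s)
      where
      cases : ⌊ ⋖⇒≤ H⋖K ⌋ ⊑ N X → ¬ (X ≤ K) ⊎ X ≤ H
      cases ⊑N with X ≤? K
      ... | yes X≤K = inj₂ (N⁻ (⊑N (⌊⌋-∋ (⋖⇒≤ H⋖K))) X≤K)
      ... | no X≰K  = inj₁ X≰K

theoremA :
  ∀ {c ℓ₁ ℓ₂} (L : Lattice c ℓ₁ ℓ₂) (finite : Finite L) → Modular L →
  let open Lattice L
      open TransferSystems L finite
  in
  (⊥ : Carrier) (⊥-min : Minimum _≤_ ⊥) →
  (⟪ J Sat ⟫ ≐ ⟪ J Tr ⟫ ∩ IsSaturatedTransferSystem)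
  × (⟪ J Sat ⟫ ≐ (λ R → ∃₂ λ H K → Σ[ H⋖K ∈ H ⋖ K ] ⌊ ⋖⇒≤ H⋖K ⌋ ≋ R))
  × (⟪ M Sat ⟫ ≐ ⟪ M Tr ⟫ ∩ IsSaturatedTransferSystem)
  × (⟪ M Sat ⟫ ≐ (λ R → ∃ λ X → ¬ (X ≈ ⊥) × ⌈ ⊥-min X ⌉ ʳˡᵖ ≋ R))
  × (∀ {H K X} (H⋖K : H ⋖ K) → ¬ (X ≈ ⊥) →
      (⌊ ⋖⇒≤ H⋖K ⌋ ⊑ ⌈ ⊥-min X ⌉ ʳˡᵖ) ⇔ (¬ (X ≤ K) ⊎ X ≤ H))
theoremA L finite modular ⊥ ⊥-min =
    -- The irreducibles of the two lattices are compared through `CoverSystem`, which does not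
    -- depend on `P`; `LiftingSystem` does the same for meets.
    ≐-trans ⟪⟫∩Sat (≐-trans InSat.J∩Sat≐covers (≐-sym InTr.J∩Sat≐covers))
  , ≐-trans ⟪⟫∩Sat InSat.J∩Sat≐covers
  , ≐-trans ⟪⟫∩Sat (≐-trans InSat.M∩Sat≐lifting (≐-sym InTr.M∩Sat≐lifting))
  , ≐-trans ⟪⟫∩Sat InSat.M∩Sat≐lifting
  , λ H⋖K _ → ⌊⋖⌋⊑N⇔ L finite ⊥ ⊥-min H⋖K
  where
  open TransferSystems L finite

  ⟪⟫∩Sat : ∀ {q} {X : Pred (∃ IsSaturatedTransferSystem) q} →
           ⟪ X ⟫ ≐ ⟪ X ⟫ ∩ IsSaturatedTransferSystem
  ⟪⟫∩Sat {X = X} = ⟪⟫-∩-Sat L finite ⊥ ⊥-min {X = X}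

  module InTr = Irreducibles L finite ⊥ ⊥-min modular
    isTransferSystem? isTransferSystem-closed id proj₁
  module InSat = Irreducibles L finite ⊥ ⊥-min modular
    isSaturatedTransferSystem? isSaturatedTransferSystem-closed proj₁ id
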